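{- Let $(G,R)$ be a finite rooted graph without sinks such that $t^{ -1}(R)=\emptyset$. If the unfolding tree $\mathcal{T}(G,R)$ is cocompact, then $(G,R)$ admits an actual labelling.
   Context: A graph $G=(VG,EG,o,t)$ is a directed multigraph (loops and multiple edges allowed) with origin and terminus maps $o,t:EG\to VG$. A sink is a vertex $v$ with $o^{ -1}(v)=\emptyset$. A path is either an empty path $\varepsilon_v$ or a finite sequence $e_1\cdots e_n$ of edges with $t(e_i)=o(e_{i+1})$; $O(p),T(p)$ denote its origin and terminus. A rooted graph $(G,R)$ is a graph with a vertex $R$ from which every vertex is reachable by a directed path. A rooted tree is a graph with a vertex $R$ such that every vertex has a unique path from $R$. The unfolding tree $\mathcal{T}(G,R)$ has as vertices the paths $p$ with $O(p)=R$ and an edge $(p,pe)$ from $p$ to $pe$ for each such $p$ and each edge $e$ with $o(e)=T(p)$. For a rooted tree $\mathcal{T}$ with root $R$ and vertex $v$, $\mathcal{T}^v$ is obtained by reversing every edge on the path from $R$ to $v$ (a rooted tree with root $v$). $\cong$ is isomorphism of directed graphs. A rooted tree $\mathcal{T}$ is cocompact if there are a finite set $F$ and $l:V\mathcal{T}\to F$ with $l(v)=l(w)\Rightarrow \mathcal{T}^v\cong\mathcal{T}^w$. Multisets over a set $X$ have positive integer multiplicities; union adds multiplicities; $M\setminus\{x\}$ removes one copy. $t_m(o^{ -1}(v))$ is the multiset of termini of edges leaving $v$, counted with the number of edges, and $l(t_m(o^{ -1}(v)))$ its multiset of labels. Actual labelling of a rooted graph $(G,R)$ with $t^{ -1}(R)=\emptyset$: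 a finite set $X$, maps $l:VG\to X$, $l_p:VG\setminus\{R\}\to X$, and multisets $M_x$ over $X$ ($x\in X$) such that for every $v\ne R$: (1) $l_p(v)\in M_{l(v)}$; (2) $l(t_m(o^{ -1}(v)))=M_{l(v)}\setminus\{l_p(v)\}$; (3) $l(o(e))=l_p(v)$ for every edge $e$ with $t(e)=v$; and (4) $l(t_m(o^{ -1}(R)))=M_{l(R)}$. -}

module Defs where

open import Data.Nat using (ℕ; zero; suc; _≤_; _∸_; _≤ᵇ_)
open import Data.Nat.ListAction using (sum)
open import Data.Fin using (Fin; _≟_)
open import Data.List using (List; []; _∷_; map; length; drop)
open import Data.List.Properties using (≡-dec)
open import Data.Bool using (Bool; true; false; if_then_else_; _∧_)
open import Data.Product using (Σ; _,_)
open import Relation.Nullary using (¬_; does)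
open import Relation.Binary.PropositionalEquality using (_≡_)
open import Function.Bundles using (_↔_; Inverse)
open import Data.Fin.Base using () renaming (toℕ to toℕ')
open import Data.List.Base using () renaming (allFin to allFinL)

record Graph : Set₁ where
  field
    V E : Set
    o t : E → V

open Graph using (V; E)

record _≅_ (G H : Graph) : Set where
  field
    vIso : V G ↔ V H
    eIso : E G ↔ E H
    o-pres : ∀ e → Graph.o H (Inverse.to eIso e) ≡ Inverse.to vIso (Graph.o G e)
    t-pres : ∀ e → Graph.t H (Inverse.to eIso e) ≡ Inverse.to vIso (Graph.t G e)

reverseOn : (H : Graph) → (E H → Bool) → Graph
reverseOn H f = record
  { V = V H ; E = E H
  ; o = λ e → if f e then Graph.t H e else Graph.o H e
  ; t = λ e → if f e then Graph.o H e else Graph.t H e }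

record FinGraph : Set where
  field
    n m : ℕ
    o t : Fin m → Fin n

module _ (G : FinGraph) where
  open FinGraph G

  data Path (v : Fin n) : Fin n → Set where
    ε    : Path v v
    snoc : (e : Fin m) → Path v (o e) → Path v (t e)

  edgesRev : ∀ {v w} → Path v w → List (Fin m)
  edgesRev ε = []
  edgesRev (snoc e p) = e ∷ edgesRev p

  Rooted : Fin n → Set
  Rooted R = ∀ v → Path R v

  NoSinks : Set
  NoSinks = ∀ v → Σ (Fin m) λ e → o e ≡ v

  NoIncomingAt : Fin n → Set
  NoIncomingAt R = ∀ e → ¬ (t e ≡ R)

  Unfolding : Fin n → Graph
  Unfolding R = record
    { V = Σ (Fin n) (Path R)
    ; E = Σ (Fin m) (λ e → Path R (o e))
    ; o = λ { (e , p) → (o e , p) }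
    ; t = λ { (e , p) → (t e , snoc e p) } }

  -- u is a suffix of w (on reversed edge lists = prefix of paths)
  suffixB : List (Fin m) → List (Fin m) → Bool
  suffixB u w = (length u ≤ᵇ length w) ∧ does (≡-dec _≟_ (drop (length w ∸ length u) w) u)

  -- the edge (e , p) of T(G,R) lies on the path from the root to q
  -- iff the path p e is a prefix of q
  onPathTo : (R : Fin n) → V (Unfolding R) → E (Unfolding R) → Bool
  onPathTo R (w , q) (e , p) = suffixB (e ∷ edgesRev p) (edgesRev q)

  Unfolding^ : (R : Fin n) → V (Unfolding R) → Graph
  Unfolding^ R q = reverseOn (Unfolding R) (onPathTo R q)

  CocompactUnfolding : Fin n → Set
  CocompactUnfolding R =
    Σ ℕ λ k → Σ (V (Unfolding R) → Fin k) λ l →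
      ∀ q q' → l q ≡ l q' → Unfolding^ R q ≅ Unfolding^ R q'

  outLabels : ∀ {k} → (Fin n → Fin k) → Fin n → Fin k → ℕ
  outLabels l v y =
    sum (map (λ e → if does (o e ≟ v) ∧ does (l (t e) ≟ y) then 1 else 0) (allFinL m))

  -- multisets over Fin k as multiplicity functions; M ∖ {x}
  removeOne : ∀ {k} → (Fin k → ℕ) → Fin k → Fin k → ℕ
  removeOne M x y = M y ∸ (if does (y ≟ x) then 1 else 0)

  record ActualLabelling (R : Fin n) : Set where
    field
      k  : ℕ
      l  : Fin n → Fin k
      lp : (v : Fin n) → ¬ (v ≡ R) → Fin k
      M  : Fin k → Fin k → ℕ        -- M x = multiplicity function of M_x
      cond1 : ∀ v (ne : ¬ (v ≡ R)) → 1 ≤ M (l v) (lp v ne)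
      cond2 : ∀ v (ne : ¬ (v ≡ R)) y → outLabels l v y ≡ removeOne (M (l v)) (lp v ne) y
      cond3 : ∀ v (ne : ¬ (v ≡ R)) e → t e ≡ v → l (o e) ≡ lp v ne
      cond4 : ∀ y → outLabels l R y ≡ M (l R) y

{-# OPTIONS --safe #-}
-- Colour the vertices of the unfolding tree T by N rounds of colour refinement
-- in the underlying undirected tree.  These colours depend only on the terminus
-- of a path: if two paths p, p′ to the same vertex first differ in round D,
-- then their common extensions by i edges first differ in round i + D.  There
-- are arbitrarily long extensions because there are no sinks, so cocompactness
-- yields i < j such that the extensions by i and by j have pairwise isomorphic
-- rerooted trees, a contradiction.  Hence the colours live on the finite graph,
-- where refinement stabilises; the stable colour of a vertex is its label, and
-- l_p is the label of a predecessor, well defined because the predecessor's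
-- colour is what remains of the next colour after cancelling the successors.
module Submission where

open import Defs
open import Data.Fin using (Fin)
open import Data.Bool using (Bool; true; false; if_then_else_; _∧_; T)
open import Data.Bool.Properties using (T-∧; T-≡)
open import Data.Empty using (⊥)
open import Data.Fin using (_≟_; toℕ; combine; remQuot)
open import Data.Fin.Properties using (pigeonhole; combine-injective; any?; all?; ¬∀⟶∃¬; remQuot-combine)
open import Data.List using (List; []; _∷_; _++_; map; length; replicate; filter; allFin; take; drop)
open import Data.List.Properties
open import Data.List.Membership.Propositional using (_∈_)
open import Data.List.Membership.Propositional.Properties using (∈-map⁺; ∈-map⁻; ∈-filter⁺; ∈-allFin; ∈-++⁺ʳ)
open import Data.List.Membership.Propositional.Properties.WithK using (unique∧set⇒bag)
open import Data.List.Relation.Binary.BagAndSetEquality using (∼bag⇒↭)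
open import Data.List.Relation.Binary.Permutation.Propositional using (_↭_; ↭-refl; ↭-sym; ↭-trans; ↭-prep; ↭-reflexive)
import Data.List.Relation.Binary.Permutation.Propositional.Properties as Perm
open import Data.List.Relation.Unary.All as All using (All; []; _∷_)
import Data.List.Relation.Unary.All.Properties as All
open import Data.List.Relation.Unary.AllPairs using (_∷_)
open import Data.List.Relation.Unary.Any using (here; there)
open import Data.List.Relation.Unary.Unique.Propositional using (Unique)
import Data.List.Relation.Unary.Unique.Propositional.Properties as Unique
open import Data.Nat using (ℕ; zero; suc; _+_; _*_; _∸_; _^_; _%_; _≤_; _<_; _≤ᵇ_; z≤n; s≤s)
open import Data.Nat.DivMod using ([m+kn]%n≡m%n; m<n⇒m%n≡m)
open import Data.Nat.ListAction using (sum)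
open import Data.Nat.ListAction.Properties using (sum-↭)
open import Data.Nat.Properties hiding (_≟_)
import Data.Nat.Properties as ℕ
open import Data.Product using (Σ; ∃; ∃₂; _×_; _,_; proj₁; proj₂)
open import Data.Sum using (_⊎_; inj₁; inj₂)
open import Function using (_∘_; id)
open import Function.Bundles using (Inverse; Equivalence; mk⇔)
open import Relation.Binary using (tri<; tri≈; tri>)
open import Relation.Binary.PropositionalEquality hiding ([_])
open import Relation.Nullary using (¬_; Dec; yes; no; contradiction; does)
open import Relation.Nullary.Decidable using (_→-dec_; dec-true; dec-false)

open Graph using (V; E)

-- Coding bounded multisets of naturals by single naturals.

module Code (d : ℕ) where

  -- In the unfolding tree `d` is the number of edges of the graph: at most `d` children and one
  -- parent make fewer than `base` neighbours.
  base : ℕ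
  base = suc (suc d)

  -- A multiset with fewer than base elements is stored as the number whose
  -- base-expansion has the multiplicities as digits.
  code : List ℕ → ℕ
  code xs = sum (map (base ^_) xs)

  base^-injective : ∀ x y → base ^ x ≡ base ^ y → x ≡ y
  base^-injective x y eq with <-cmp x y
  ... | tri< x<y _ _ = contradiction eq (<⇒≢ (^-monoʳ-< base (s≤s (s≤s z≤n)) x<y))
  ... | tri≈ _ x≡y _ = x≡y
  ... | tri> _ _ x>y = contradiction (sym eq) (<⇒≢ (^-monoʳ-< base (s≤s (s≤s z≤n)) x>y))

  code-cancelʳ : ∀ x y zs ws → code zs ≡ code ws → code (x ∷ zs) ≡ code (y ∷ ws) → x ≡ y
  code-cancelʳ x y zs ws tails eq =
    base^-injective x y (+-cancelʳ-≡ (code zs) _ _ (trans eq (cong (base ^ y +_) (sym tails))))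

  code-↭ : ∀ {xs ys} → xs ↭ ys → code xs ≡ code ys
  code-↭ p = sum-↭ (Perm.map⁺ (base ^_) p)

  private
    fromDigits : ℕ → List ℕ → List ℕ
    fromDigits a xs = replicate a 0 ++ map suc xs

    splitZeros : ∀ xs → ∃₂ λ a ys → xs ↭ fromDigits a ys
    splitZeros [] = 0 , [] , ↭-refl
    splitZeros (zero ∷ xs) with a , ys , p ← splitZeros xs = suc a , ys , ↭-prep 0 p
    splitZeros (suc x ∷ xs) with a , ys , p ← splitZeros xs =
      a , x ∷ ys , ↭-trans (↭-prep (suc x) p) (↭-sym (Perm.shift (suc x) (replicate a 0) (map suc ys)))

    code-map-suc : ∀ xs → code (map suc xs) ≡ code xs * base
    code-map-suc [] = refl
    code-map-suc (x ∷ xs) = begin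
      base * base ^ x + code (map suc xs) ≡⟨ cong₂ _+_ (*-comm base (base ^ x)) (code-map-suc xs) ⟩
      base ^ x * base + code xs * base    ≡⟨ *-distribʳ-+ base (base ^ x) (code xs) ⟨
      code (x ∷ xs) * base                ∎
      where open ≡-Reasoning

    code-fromDigits : ∀ a xs → code (fromDigits a xs) ≡ a + code xs * base
    code-fromDigits zero    xs = code-map-suc xs
    code-fromDigits (suc a) xs = cong suc (code-fromDigits a xs)

    length-fromDigits : ∀ a xs → length (fromDigits a xs) ≡ a + length xs
    length-fromDigits zero    xs = length-map suc xs
    length-fromDigits (suc a) xs = cong suc (length-fromDigits a xs)

    digit-unique : ∀ {a a′ s s′} → a < base → a′ < base →
                   a + s * base ≡ a′ + s′ * base → a ≡ a′ × s ≡ s′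
    digit-unique {a} {a′} {s} {s′} a< a′< eq = a≡a′ , s≡s′
      where
      open ≡-Reasoning
      a≡a′ : a ≡ a′
      a≡a′ = begin
        a                       ≡⟨ m<n⇒m%n≡m a< ⟨
        a % base                ≡⟨ [m+kn]%n≡m%n a s base ⟨
        (a + s * base) % base   ≡⟨ cong (_% base) eq ⟩
        (a′ + s′ * base) % base ≡⟨ [m+kn]%n≡m%n a′ s′ base ⟩
        a′ % base               ≡⟨ m<n⇒m%n≡m a′< ⟩
        a′                      ∎
      s≡s′ : s ≡ s′
      s≡s′ = *-cancelʳ-≡ s s′ base
        (+-cancelˡ-≡ a _ _ (trans eq (cong (_+ s′ * base) (sym a≡a′))))

    code-nonempty : ∀ x xs → 0 < code (x ∷ xs)
    code-nonempty x xs = ≤-trans (m^n>0 base x) (m≤m+n _ (code xs))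

    quotient-decreases : ∀ a s → 0 < a + s * base → s < a + s * base
    quotient-decreases a zero    pos = pos
    quotient-decreases a (suc s) pos =
      ≤-trans (m<m*n (suc s) base (s≤s (s≤s z≤n))) (m≤n+m _ a)

    -- Induction on a bound for the code, because lowering all entries by one need not shorten the
    -- list. The number of zeros is the lowest digit, as the length bound keeps it below `base`;
    -- equal lowest digits leave equal quotients, and these code the lowered nonzero entries.
    code-injective′ : ∀ fuel xs ys → code xs ≤ fuel → length xs < base → length ys < base →
                      code xs ≡ code ys → xs ↭ ys
    code-injective′ fuel [] [] _ _ _ _ = ↭-refl
    code-injective′ fuel [] (y ∷ ys) _ _ _ eq = contradiction eq (<⇒≢ (code-nonempty y ys))
    code-injective′ zero (x ∷ xs) ys le _ _ _ = contradiction le (<⇒≱ (code-nonempty x xs))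
    code-injective′ (suc fuel) xs₀@(x ∷ xs) ys le lx ly eq
      with a , us , p ← splitZeros xs₀ | a′ , vs , q ← splitZeros ys =
      ↭-trans p (↭-trans (↭-reflexive (cong (λ z → fromDigits z us) a≡a′))
        (↭-trans (Perm.++⁺ˡ (replicate a′ 0) (Perm.map⁺ suc us↭vs)) (↭-sym q)))
      where
      codeˡ : code xs₀ ≡ a + code us * base
      codeˡ = trans (code-↭ p) (code-fromDigits a us)
      codeʳ : code ys ≡ a′ + code vs * base
      codeʳ = trans (code-↭ q) (code-fromDigits a′ vs)
      lenˡ : a + length us < base
      lenˡ = subst (_< base) (trans (Perm.↭-length p) (length-fromDigits a us)) lx
      lenʳ : a′ + length vs < base
      lenʳ = subst (_< base) (trans (Perm.↭-length q) (length-fromDigits a′ vs)) ly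
      digits : a ≡ a′ × code us ≡ code vs
      digits = digit-unique (m+n≤o⇒m≤o (suc a) lenˡ) (m+n≤o⇒m≤o (suc a′) lenʳ)
                 (trans (sym codeˡ) (trans eq codeʳ))
      a≡a′ = proj₁ digits
      smaller : code us < code xs₀
      smaller = subst (code us <_) (sym codeˡ)
        (quotient-decreases a (code us) (subst (0 <_) codeˡ (code-nonempty x xs)))
      us↭vs : us ↭ vs
      us↭vs = code-injective′ fuel us vs (≤-pred (≤-trans smaller le))
                (m+n≤o⇒n≤o a (subst (_≤ base) (sym (+-suc a _)) lenˡ))
                (m+n≤o⇒n≤o a′ (subst (_≤ base) (sym (+-suc a′ _)) lenʳ)) (proj₂ digits)

  code-injective : ∀ {xs ys} → length xs < base → length ys < base → code xs ≡ code ys → xs ↭ ys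
  code-injective {xs} {ys} = code-injective′ (code xs) xs ys ≤-refl

map-proj₁-toList : ∀ {A : Set} {P : A → Set} {xs : List A} (pxs : All P xs) →
                   map proj₁ (All.toList pxs) ≡ xs
map-proj₁-toList []         = refl
map-proj₁-toList (px ∷ pxs) = cong (_ ∷_) (map-proj₁-toList pxs)

-- Undirected adjacency, which edge reversal preserves and isomorphisms transport.

Adj : (H : Graph) → V H → V H → Set
Adj H x y = Σ (E H) λ e → (Graph.o H e ≡ x × Graph.t H e ≡ y) ⊎ (Graph.o H e ≡ y × Graph.t H e ≡ x)

reverse-Adj⁺ : ∀ H f {x y} → Adj H x y → Adj (reverseOn H f) x y
reverse-Adj⁺ H f {x} {y} (e , inc) = e , swapped inc
  where
  swapped : (Graph.o H e ≡ x × Graph.t H e ≡ y) ⊎ (Graph.o H e ≡ y × Graph.t H e ≡ x) →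
            (Graph.o (reverseOn H f) e ≡ x × Graph.t (reverseOn H f) e ≡ y) ⊎
            (Graph.o (reverseOn H f) e ≡ y × Graph.t (reverseOn H f) e ≡ x)
  swapped inc with f e
  swapped inc             | false = inc
  swapped (inj₁ (ox , ty)) | true  = inj₂ (ty , ox)
  swapped (inj₂ (oy , tx)) | true  = inj₁ (tx , oy)

reverse-Adj⁻ : ∀ H f {x y} → Adj (reverseOn H f) x y → Adj H x y
reverse-Adj⁻ H f {x} {y} (e , inc) = e , swapped inc
  where
  swapped : (Graph.o (reverseOn H f) e ≡ x × Graph.t (reverseOn H f) e ≡ y) ⊎
            (Graph.o (reverseOn H f) e ≡ y × Graph.t (reverseOn H f) e ≡ x) →
            (Graph.o H e ≡ x × Graph.t H e ≡ y) ⊎ (Graph.o H e ≡ y × Graph.t H e ≡ x)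
  swapped inc with f e
  swapped inc             | false = inc
  swapped (inj₁ (ty , ox)) | true  = inj₂ (ox , ty)
  swapped (inj₂ (tx , oy)) | true  = inj₁ (oy , tx)

module _ {H K : Graph} (iso : H ≅ K) where
  open _≅_ iso
  private
    module φ = Inverse vIso
    module ψ = Inverse eIso

  ≅-vertex-injective : ∀ {x y} → φ.to x ≡ φ.to y → x ≡ y
  ≅-vertex-injective {x} {y} eq = trans (sym (φ.strictlyInverseʳ x)) (trans (cong φ.from eq) (φ.strictlyInverseʳ y))

  ≅-o-from : ∀ e → φ.to (Graph.o H (ψ.from e)) ≡ Graph.o K e
  ≅-o-from e = trans (sym (o-pres (ψ.from e))) (cong (Graph.o K) (ψ.strictlyInverseˡ e))

  ≅-t-from : ∀ e → φ.to (Graph.t H (ψ.from e)) ≡ Graph.t K e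
  ≅-t-from e = trans (sym (t-pres (ψ.from e))) (cong (Graph.t K) (ψ.strictlyInverseˡ e))

  ≅-Adj⁺ : ∀ {x y} → Adj H x y → Adj K (φ.to x) (φ.to y)
  ≅-Adj⁺ (e , inj₁ (refl , refl)) = ψ.to e , inj₁ (o-pres e , t-pres e)
  ≅-Adj⁺ (e , inj₂ (refl , refl)) = ψ.to e , inj₂ (o-pres e , t-pres e)

  ≅-Adj⁻ : ∀ {x y} → Adj K (φ.to x) y → ∃ λ z → y ≡ φ.to z × Adj H x z
  ≅-Adj⁻ (e , inj₁ (ox , refl)) =
    _ , sym (≅-t-from e) , ψ.from e , inj₁ (≅-vertex-injective (trans (≅-o-from e) ox) , refl)
  ≅-Adj⁻ (e , inj₂ (refl , tx)) =
    _ , sym (≅-o-from e) , ψ.from e , inj₂ (refl , ≅-vertex-injective (trans (≅-t-from e) tx))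

-- Colour refinement on the undirected unfolding tree.

module Tree (G : FinGraph) (R : Fin (FinGraph.n G)) where
  open FinGraph G public
  open Code m public

  U : Graph
  U = Unfolding G R

  edges : V U → List (Fin m)
  edges (_ , p) = edgesRev G p

  edgesRev-injective : ∀ {v w} (p : Path G R v) (q : Path G R w) →
                       edgesRev G p ≡ edgesRev G q → _≡_ {A = V U} (v , p) (w , q)
  edgesRev-injective ε          ε           _  = refl
  edgesRev-injective (snoc e p) (snoc e′ q) eq with ∷-injective eq
  ... | refl , eq′ with refl ← edgesRev-injective p q eq′ = refl

  edges-injective : ∀ x y → edges x ≡ edges y → x ≡ y
  edges-injective (_ , p) (_ , q) = edgesRev-injective p q

  OutEdge : Fin n → Set
  OutEdge v = Σ (Fin m) λ e → o e ≡ v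

  outEdges : ∀ v → List (OutEdge v)
  outEdges v = All.toList (All.all-filter (λ e → o e ≟ v) (allFin m))

  extend : ∀ {v} → Path G R v → OutEdge v → V U
  extend p (e , refl) = t e , snoc e p

  parents : V U → List (V U)
  parents (_ , ε)        = []
  parents (_ , snoc e p) = (o e , p) ∷ []

  children : V U → List (V U)
  children (v , p) = map (extend p) (outEdges v)

  nbrs : V U → List (V U)
  nbrs x = parents x ++ children x

  edges-extend : ∀ {v} (p : Path G R v) e → edges (extend p e) ≡ proj₁ e ∷ edgesRev G p
  edges-extend p (e , refl) = refl

  proj₁-outEdges : ∀ v → map proj₁ (outEdges v) ≡ filter (λ e → o e ≟ v) (allFin m)
  proj₁-outEdges v = map-proj₁-toList (All.all-filter (λ e → o e ≟ v) (allFin m))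

  unique-outEdges : ∀ v → Unique (outEdges v)
  unique-outEdges v = Unique.map⁻ (subst Unique (sym (proj₁-outEdges v))
                        (Unique.filter⁺ (λ e → o e ≟ v) (Unique.allFin⁺ m)))

  ∈-outEdges : ∀ e → (e , refl) ∈ outEdges (o e)
  ∈-outEdges e
    with (_ , refl) , e∈ , refl ← ∈-map⁻ proj₁ (subst (e ∈_) (sym (proj₁-outEdges (o e)))
                                     (∈-filter⁺ (λ e′ → o e′ ≟ o e) (∈-allFin e) refl)) = e∈

  extend-injective : ∀ {v} (p : Path G R v) {e e′} → extend p e ≡ extend p e′ → e ≡ e′
  extend-injective p {e , refl} {e′ , eq} same
    with refl ← ∷-injectiveˡ (trans (cong edges same) (edges-extend p (e′ , eq)))
    with refl ← eq = refl

  unique-children : ∀ x → Unique (children x)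
  unique-children (v , p) = Unique.map⁺ (extend-injective p) (unique-outEdges v)

  parent≢child : ∀ {v} e (p : Path G R (o e)) (f : OutEdge v) (eq : v ≡ t e) →
                 ¬ ((o e , p) ≡ extend (subst (Path G R) (sym eq) (snoc e p)) f)
  parent≢child e p f refl same =
    <⇒≢ (≤-trans (n<1+n _) (n≤1+n _)) (cong length (trans (cong edges same) (edges-extend (snoc e p) f)))

  -- A child is two edges longer than the parent, so the two never coincide. Without repetitions,
  -- `nbrs x` is determined up to permutation by its set of members, that is, by `Adj`.
  unique-nbrs : ∀ x → Unique (nbrs x)
  unique-nbrs x@(_ , ε)        = unique-children x
  unique-nbrs x@(_ , snoc e p) =
    All.map⁺ (All.tabulate λ {f} _ → parent≢child e p f refl) ∷ unique-children x

  ∈-nbrs⇒Adj : ∀ {x y} → y ∈ nbrs x → Adj U x y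
  ∈-nbrs⇒Adj {_ , ε} y∈ with (e , refl) , _ , refl ← ∈-map⁻ (extend ε) y∈ =
    (e , ε) , inj₁ (refl , refl)
  ∈-nbrs⇒Adj {_ , snoc e p} (here refl) = (e , p) , inj₂ (refl , refl)
  ∈-nbrs⇒Adj {_ , snoc e p} (there y∈)
    with (e′ , eq) , _ , refl ← ∈-map⁻ (extend (snoc e p)) y∈ = child eq
    where
    child : ∀ {v} {p : Path G R v} {e} (eq : o e ≡ v) → Adj U (v , p) (extend p (e , eq))
    child {p = p} {e} refl = (e , p) , inj₁ (refl , refl)

  Adj⇒∈-nbrs : ∀ {x y} → Adj U x y → y ∈ nbrs x
  Adj⇒∈-nbrs ((e , p) , inj₁ (refl , refl)) =
    ∈-++⁺ʳ (parents (o e , p)) (∈-map⁺ (extend p) (∈-outEdges e))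
  Adj⇒∈-nbrs ((e , p) , inj₂ (refl , refl)) = here refl

  -- A round records the neighbours' colours only, not the old colour of `x`; that rounds still
  -- refine one another is shown in `c-refines`.
  colour : ℕ → V U → ℕ
  colour zero    x = 0
  colour (suc N) x = code (map (colour N) (nbrs x))

  module _ (φ : V U → V U) (injective : ∀ {x y} → φ x ≡ φ y → x ≡ y)
           (Adj⁺ : ∀ {x y} → Adj U x y → Adj U (φ x) (φ y))
           (Adj⁻ : ∀ {x y} → Adj U (φ x) y → ∃ λ z → y ≡ φ z × Adj U x z) where

    nbrs-equivariant : ∀ x → map φ (nbrs x) ↭ nbrs (φ x)
    nbrs-equivariant x = ∼bag⇒↭ (unique∧set⇒bag (Unique.map⁺ injective (unique-nbrs x)) (unique-nbrs (φ x))
      (mk⇔ to from))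
      where
      to : ∀ {y} → y ∈ map φ (nbrs x) → y ∈ nbrs (φ x)
      to y∈ with z , z∈ , refl ← ∈-map⁻ φ y∈ = Adj⇒∈-nbrs (Adj⁺ (∈-nbrs⇒Adj z∈))
      from : ∀ {y} → y ∈ nbrs (φ x) → y ∈ map φ (nbrs x)
      from y∈ with z , refl , adj ← Adj⁻ (∈-nbrs⇒Adj y∈) = ∈-map⁺ φ (Adj⇒∈-nbrs adj)

    colour-equivariant : ∀ N x → colour N x ≡ colour N (φ x)
    colour-equivariant zero    x = refl
    colour-equivariant (suc N) x = begin
      code (map (colour N) (nbrs x))         ≡⟨ cong code (map-cong (colour-equivariant N) (nbrs x)) ⟩
      code (map (colour N ∘ φ) (nbrs x))     ≡⟨ cong code (map-∘ (nbrs x)) ⟩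
      code (map (colour N) (map φ (nbrs x))) ≡⟨ code-↭ (Perm.map⁺ (colour N) (nbrs-equivariant x)) ⟩
      code (map (colour N) (nbrs (φ x)))     ∎
      where open ≡-Reasoning

  -- Rerooted trees: the new root is recognisable, so isomorphisms preserve colours.

  suffixB-complete : ∀ (us ws : List (Fin m)) → T (suffixB G us (ws ++ us))
  suffixB-complete us ws = Equivalence.from T-∧ (≤⇒≤ᵇ longer ,
    Equivalence.from T-≡ (dec-true (≡-dec _≟_ (drop (length (ws ++ us) ∸ length us) (ws ++ us)) us) dropped))
    where
    len : length (ws ++ us) ∸ length us ≡ length ws
    len = trans (cong (_∸ length us) (length-++ ws)) (m+n∸n≡m (length ws) (length us))
    longer : length us ≤ length (ws ++ us)
    longer = subst (length us ≤_) (sym (length-++ ws)) (m≤n+m (length us) (length ws))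
    drop-length-++ : ∀ (ws : List (Fin m)) → drop (length ws) (ws ++ us) ≡ us
    drop-length-++ []       = refl
    drop-length-++ (w ∷ ws) = drop-length-++ ws
    dropped : drop (length (ws ++ us) ∸ length us) (ws ++ us) ≡ us
    dropped = trans (cong (λ i → drop i (ws ++ us)) len) (drop-length-++ ws)

  suffixB-sound : ∀ (us ws : List (Fin m)) → T (suffixB G us ws) → ∃ λ vs → ws ≡ vs ++ us
  suffixB-sound us ws suffix
    with ≡-dec _≟_ (drop (length ws ∸ length us) ws) us | Equivalence.to (T-∧ {length us ≤ᵇ length ws}) suffix
  ... | yes eq | _ = take k ws , trans (sym (take++drop≡id k ws)) (cong (take k ws ++_) eq)
    where k = length ws ∸ length us
  ... | no _ | _ , ()

  -- For a proper ancestor `y` of `x`, this finds the edge by which the path to `x` leaves `y`; its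
  -- reversal enters `y` in `U^ x`. The induction climbs from `x` to its parent, and edges on the
  -- path to the parent are also on the path to `x`.
  above : ∀ vs x y → edges x ≡ vs ++ edges y →
          y ≡ x ⊎ Σ (E U) λ e → Graph.o U e ≡ y × T (onPathTo G R x e)
  above [] x y eq = inj₁ (edges-injective y x (sym eq))
  above (v ∷ vs) (_ , snoc e p) y eq with above vs (o e , p) y (∷-injectiveʳ eq)
  ... | inj₁ refl = inj₂ ((e , p) , refl , suffixB-complete (e ∷ edgesRev G p) [])
  ... | inj₂ ((e′ , p′) , refl , suffix)
    with us , eq′ ← suffixB-sound (e′ ∷ edgesRev G p′) (edgesRev G p) suffix =
    inj₂ ((e′ , p′) , refl , subst (T ∘ suffixB G (e′ ∷ edgesRev G p′)) (sym (cong (e ∷_) eq′))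
                               (suffixB-complete (e′ ∷ edgesRev G p′) (e ∷ us)))

  U^ : V U → Graph
  U^ = Unfolding^ G R

  -- With `root-or-edge-into`, this makes `x` the only vertex of `U^ x` without incoming edges. A
  -- reversed edge ending at `x` would start at `x` in `U` and yet lie on the path to `x`, which its
  -- length forbids; an edge of `U` ending at `x` lies on that path and is reversed.
  no-edge-into-root : ∀ x e → ¬ (Graph.t (U^ x) e ≡ x)
  no-edge-into-root x (e , p) eq with onPathTo G R x (e , p) in onPath
  no-edge-into-root x (e , p) refl | true
    with us , eq ← suffixB-sound (e ∷ edgesRev G p) (edgesRev G p) (Equivalence.from T-≡ onPath) =
    <⇒≢ (≤-trans (n<1+n _) (m≤n+m _ (length us))) (trans (cong length eq) (length-++ us))
  no-edge-into-root x (e , p) refl | false =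
    subst T onPath (suffixB-complete (e ∷ edgesRev G p) [])

  t-reversed : ∀ x e → T (onPathTo G R x e) → Graph.t (U^ x) e ≡ Graph.o U e
  t-reversed x e onPath with true ← onPathTo G R x e = refl

  -- The edge of `U` into `y` still enters `y` unless it is reversed. In that case, or if `y` is the
  -- empty path, `y` is a prefix of `x`, and `above` applies.
  root-or-edge-into : ∀ x y → y ≡ x ⊎ ∃ λ e → Graph.t (U^ x) e ≡ y
  root-or-edge-into x y@(_ , ε) with above (edges x) x y (sym (++-identityʳ (edges x)))
  ... | inj₁ eq = inj₁ eq
  ... | inj₂ (e , oe , onPath) = inj₂ (e , trans (t-reversed x e onPath) oe)
  root-or-edge-into x y@(_ , snoc e p) with onPathTo G R x (e , p) in eq
  ... | false = inj₂ ((e , p) , unreversed)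
    where
    unreversed : Graph.t (U^ x) (e , p) ≡ y
    unreversed rewrite eq = refl
  ... | true with us , eq′ ← suffixB-sound (e ∷ edgesRev G p) (edges x) (Equivalence.from T-≡ eq)
    with above us x y eq′
  ...   | inj₁ y≡x = inj₁ y≡x
  ...   | inj₂ (e′ , oe , onPath) = inj₂ (e′ , trans (t-reversed x e′ onPath) oe)

  ≅-root : ∀ {x y} (iso : U^ x ≅ U^ y) → Inverse.to (_≅_.vIso iso) x ≡ y
  ≅-root {x} {y} iso with root-or-edge-into y (Inverse.to (_≅_.vIso iso) x)
  ... | inj₁ eq = eq
  ... | inj₂ (e , te) = contradiction (≅-vertex-injective iso (trans (≅-t-from iso e) te))
                          (no-edge-into-root x (Inverse.from (_≅_.eIso iso) e))

  -- Forgetting directions turns the isomorphism into a map of the undirected tree `U` that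
  -- preserves neighbourhoods, hence colours, and `≅-root` says that it takes `x` to `y`.
  ≅⇒colour : ∀ {x y} → U^ x ≅ U^ y → ∀ N → colour N x ≡ colour N y
  ≅⇒colour {x} {y} iso N = trans
    (colour-equivariant (Inverse.to (_≅_.vIso iso)) (≅-vertex-injective iso) adj⁺ adj⁻ N x)
    (cong (colour N) (≅-root {x} {y} iso))
    where
    adj⁺ : ∀ {z w} → Adj U z w → Adj U (Inverse.to (_≅_.vIso iso) z) (Inverse.to (_≅_.vIso iso) w)
    adj⁺ = reverse-Adj⁻ U (onPathTo G R y) ∘ ≅-Adj⁺ iso ∘ reverse-Adj⁺ U (onPathTo G R x)
    adj⁻ : ∀ {z w} → Adj U (Inverse.to (_≅_.vIso iso) z) w →
           ∃ λ u → w ≡ Inverse.to (_≅_.vIso iso) u × Adj U z u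
    adj⁻ adj with u , eq , adj′ ← ≅-Adj⁻ iso (reverse-Adj⁺ U (onPathTo G R y) adj) =
      u , eq , reverse-Adj⁻ U (onPathTo G R x) adj′

-- Colours depend only on the terminus of a path.

module Colours (G : FinGraph) (R : Fin (FinGraph.n G)) where
  open Tree G R public

  map-children : ∀ {A : Set} (f : V U → A) {w} (q q′ : Path G R w) →
                 (∀ e → f (extend q e) ≡ f (extend q′ e)) →
                 map f (children (w , q)) ≡ map f (children (w , q′))
  map-children f {w} q q′ same = begin
    map f (children (w , q))           ≡⟨ map-∘ (outEdges w) ⟨
    map (f ∘ extend q) (outEdges w)    ≡⟨ map-cong same (outEdges w) ⟩
    map (f ∘ extend q′) (outEdges w)   ≡⟨ map-∘ (outEdges w) ⟩
    map f (children (w , q′))          ∎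
    where open ≡-Reasoning

  -- The children contribute equal summands to both codes, and cancelling them leaves the parents.
  -- The parents are given by equations because those of a path transported along an equality do not
  -- compute, as in `c-origin`.
  colour-parent : ∀ N {w} (q q′ : Path G R w) {x y} →
                  parents (w , q) ≡ x ∷ [] → parents (w , q′) ≡ y ∷ [] →
                  (∀ e → colour N (extend q e) ≡ colour N (extend q′ e)) →
                  colour (suc N) (w , q) ≡ colour (suc N) (w , q′) → colour N x ≡ colour N y
  colour-parent N {w} q q′ {x} {y} px py same eq =
    code-cancelʳ (colour N x) (colour N y) (map (colour N) (children (w , q))) (map (colour N) (children (w , q′)))
      (cong code (map-children (colour N) q q′ same))
      (trans (cong (λ ps → code (map (colour N) (ps ++ children (w , q)))) (sym px))
        (trans eq (cong (λ ps → code (map (colour N) (ps ++ children (w , q′)))) py)))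

  module _ {v} (p p′ : Path G R v) where

    data CommonExtension : ℕ → ∀ {w} → Path G R w → Path G R w → Set where
      none : CommonExtension 0 p p′
      step : ∀ {i} e {q q′ : Path G R (o e)} → CommonExtension i q q′ →
             CommonExtension (suc i) (snoc e q) (snoc e q′)

    longExtension : NoSinks G → ∀ i → Σ (Fin n) λ w → ∃₂ λ (q q′ : Path G R w) → CommonExtension i q q′
    longExtension noSinks zero = v , p , p′ , none
    longExtension noSinks (suc i) with w , q , q′ , ext ← longExtension noSinks i
      with e , refl ← noSinks w = t e , snoc e q , snoc e q′ , step e ext

    -- If p and p′ first differ in round D, then their common extensions by i
    -- edges first differ in round i + D.
    module _ (D : ℕ) (agree : ∀ j → j < D → colour j (v , p) ≡ colour j (v , p′))
             (differ : ¬ colour D (v , p) ≡ colour D (v , p′)) where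

      -- Induction on the round `j`, not on the length: the parents are a shorter pair and the
      -- children a longer one, but both are consulted one round earlier, within the range of
      -- agreement.
      extensions-agree : ∀ j {i w} {q q′ : Path G R w} → CommonExtension i q q′ → j < i + D →
                         colour j (w , q) ≡ colour j (w , q′)

      children-agree : ∀ j {i w} {q q′ : Path G R w} → CommonExtension i q q′ → j < suc i + D →
                       ∀ e → colour j (extend q e) ≡ colour j (extend q′ e)
      children-agree j ext j< (e , refl) = extensions-agree j (step e ext) j<

      extensions-agree zero    _    _  = refl
      extensions-agree (suc j) none j< = agree (suc j) j<
      extensions-agree (suc j) (step e {q} {q′} ext) j< =
        cong₂ (λ c cs → code (c ∷ cs)) (extensions-agree j ext (≤-pred j<))
          (map-children (colour j) (snoc e q) (snoc e q′)
            (children-agree j (step e ext) (≤-trans (<⇒≤ j<) (n≤1+n _))))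

      -- Children of the extended pair still agree in round `i + D`, so equal colours one round
      -- later would force equal colours of the parents in round `i + D`, against the induction
      -- hypothesis.
      extensions-differ : ∀ {i w} {q q′ : Path G R w} → CommonExtension i q q′ →
                          ¬ colour (i + D) (w , q) ≡ colour (i + D) (w , q′)
      extensions-differ none = differ
      extensions-differ {suc i} (step e {q} {q′} ext) eq =
        extensions-differ ext (colour-parent (i + D) (snoc e q) (snoc e q′) refl refl
          (children-agree (i + D) (step e ext) (≤-trans (n<1+n _) (n≤1+n _))) eq)

      -- Two pairs of extensions of different lengths with the same labels are
      -- isomorphic, so they would first differ in the same round.
      no-first-difference : NoSinks G → CocompactUnfolding G R → ⊥
      no-first-difference noSinks (k , l , iso) =
        -- A pair of extensions has one of `k * k` pairs of labels, so `k * k + 1` lengths force a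
        -- repetition.
        let i , j , i<j , same = pigeonhole (n<1+n (k * k)) labels
        in extensions-differ (ext i) (clash i j i<j same)
        where
        open ≡-Reasoning
        module At (i : Fin (suc (k * k))) where
          long = longExtension noSinks (toℕ i)
          left right : V U
          left  = proj₁ long , proj₁ (proj₂ long)
          right = proj₁ long , proj₁ (proj₂ (proj₂ long))
          ext : CommonExtension (toℕ i) (proj₂ left) (proj₂ right)
          ext = proj₂ (proj₂ (proj₂ long))
        open At
        labels : Fin (suc (k * k)) → Fin (k * k)
        labels i = combine (l (left i)) (l (right i))
        labels-injective : ∀ {i j} → labels i ≡ labels j → l (left i) ≡ l (left j) × l (right i) ≡ l (right j)
        labels-injective {i} {j} = combine-injective (l (left i)) (l (right i)) (l (left j)) (l (right j))
        clash : ∀ i j → toℕ i < toℕ j → labels i ≡ labels j →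
                colour (toℕ i + D) (left i) ≡ colour (toℕ i + D) (right i)
        -- In round `r` the shorter pair differs for the first time, while the longer pair still
        -- agrees.
        clash i j i<j same = begin
          colour r (left i)  ≡⟨ ≅⇒colour (iso _ _ (proj₁ (labels-injective {i} {j} same))) r ⟩
          colour r (left j)  ≡⟨ extensions-agree r (ext j) (+-monoˡ-< D i<j) ⟩
          colour r (right j) ≡⟨ ≅⇒colour (iso _ _ (proj₂ (labels-injective {i} {j} same))) r ⟨
          colour r (right i) ∎
          where r = toℕ i + D

    -- If all rounds before `N` agree, a difference in round `N` would be a first difference;
    -- equality of colours is decidable, so excluding it gives agreement.
    colour-terminus : NoSinks G → CocompactUnfolding G R → ∀ N → colour N (v , p) ≡ colour N (v , p′)
    colour-terminus noSinks cocompact N = below (suc N) N (n<1+n N)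
      where
      below : ∀ N j → j < N → colour j (v , p) ≡ colour j (v , p′)
      below (suc N) j j<1+N with m<1+n⇒m<n∨m≡n j<1+N
      ... | inj₁ j<N = below N j j<N
      ... | inj₂ refl with colour N (v , p) ℕ.≟ colour N (v , p′)
      ...   | yes eq = eq
      ...   | no neq = contradiction cocompact (no-first-difference N (below N) neq noSinks)

-- Representatives of colour classes, and stabilisation of decreasing families.

module _ {n : ℕ} (default : Fin n) where

  representative : (Fin n → ℕ) → ℕ → Fin n
  representative f x with any? (λ u → f u ℕ.≟ x)
  ... | yes (u , _) = u
  -- Reached only for numbers that are not values of `f`.
  ... | no _        = default

  representative-correct : ∀ (f : Fin n → ℕ) v → f (representative f (f v)) ≡ f v
  representative-correct f v with any? (λ u → f u ℕ.≟ f v)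
  ... | yes (_ , eq) = eq
  ... | no none      = contradiction (v , refl) none

  -- Since `g` is constant on the fibres of `f`, it factors through `f` by way of `representative`,
  -- and the second factor can be mapped over the permutation.
  map-↭-coarsen : ∀ {A : Set} (f : Fin n → ℕ) (g : Fin n → A) → (∀ u v → f u ≡ f v → g u ≡ g v) →
                  ∀ {xs ys} → map f xs ↭ map f ys → map g xs ↭ map g ys
  map-↭-coarsen f g coarser {xs} {ys} p =
    ↭-trans (↭-reflexive (factor xs)) (↭-trans (Perm.map⁺ g′ p) (↭-sym (↭-reflexive (factor ys))))
    where
    g′ = g ∘ representative f
    factor : ∀ zs → map g zs ≡ map g′ (map f zs)
    factor zs = trans (map-cong (λ z → sym (coarser _ z (representative-correct f z))) zs) (map-∘ zs)

-- Otherwise each of the `k + 1` rounds from 0 to `k` loses an element of `Fin k`. Two of them lose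
-- the same one, although what is lost in the earlier round cannot be present in the later.
decreasing-stabilises : ∀ {k} (P : ℕ → Fin k → Set) → (∀ N a → Dec (P N a)) →
                        (∀ N a → P (suc N) a → P N a) → ∃ λ N → ∀ a → P N a → P (suc N) a
decreasing-stabilises {k} P P? decreasing
  with any? (λ (i : Fin (suc k)) → all? λ a → P? (toℕ i) a →-dec P? (suc (toℕ i)) a)
... | yes (i , stable) = toℕ i , stable
... | no unstable = contradiction (pigeonhole (n<1+n k) (proj₁ ∘ lost)) no-collision
  where
  lost : ∀ i → ∃ λ a → P (toℕ i) a × ¬ P (suc (toℕ i)) a
  lost i with a , ¬imp ← ¬∀⟶∃¬ k _ (λ a → P? (toℕ i) a →-dec P? (suc (toℕ i)) a)
                            (λ stable → unstable (i , stable))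
    with P? (toℕ i) a
  ... | yes p = a , p , λ q → ¬imp (λ _ → q)
  ... | no ¬p = contradiction (λ p → contradiction p ¬p) ¬imp
  shrink : ∀ {M} N {a} → M ≤ N → P N a → P M a
  shrink N M≤N p with m≤n⇒m<n∨m≡n M≤N
  shrink N       M≤N p | inj₂ refl = p
  shrink (suc N) M≤N p | inj₁ M<1+N = shrink N (≤-pred M<1+N) (decreasing N _ p)
  no-collision : ¬ ∃₂ λ i j → toℕ i < toℕ j × proj₁ (lost i) ≡ proj₁ (lost j)
  no-collision (i , j , i<j , same) =
    proj₂ (proj₂ (lost i)) (shrink (toℕ j) i<j (subst (P (toℕ j)) (sym same) (proj₁ (proj₂ (lost j)))))

-- Multiplicities in lists.

indicator : Bool → ℕ
indicator b = if b then 1 else 0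

count : ∀ {k} → Fin k → List (Fin k) → ℕ
count y xs = sum (map (λ x → indicator (does (x ≟ y))) xs)

count-here : ∀ {k} (y : Fin k) xs → 1 ≤ count y (y ∷ xs)
count-here y xs rewrite dec-true (y ≟ y) refl = s≤s z≤n

count-∷-∸ : ∀ {k} (y x : Fin k) xs → count y (x ∷ xs) ∸ indicator (does (y ≟ x)) ≡ count y xs
count-∷-∸ y x xs with y ≟ x
... | yes refl rewrite dec-true (y ≟ y) refl = refl
-- `count` and `removeOne` test the equality in opposite orders.
... | no y≢x rewrite dec-false (x ≟ y) (y≢x ∘ sym) = refl

sum-filter : ∀ {A : Set} {P : A → Set} (P? : ∀ x → Dec (P x)) (b : A → Bool) xs →
             sum (map (λ x → indicator (does (P? x) ∧ b x)) xs) ≡ sum (map (indicator ∘ b) (filter P? xs))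
sum-filter P? b [] = refl
sum-filter P? b (x ∷ xs) with does (P? x)
... | true  = cong (indicator (b x) +_) (sum-filter P? b xs)
... | false = sum-filter P? b xs

-- The stable colouring of the finite graph and the actual labelling.

module Labelling (G : FinGraph) (R : Fin (FinGraph.n G)) (rooted : Rooted G R) (noSinks : NoSinks G)
                 (noIncoming : NoIncomingAt G R) (cocompact : CocompactUnfolding G R) where
  open Colours G R

  termini : V U → List (Fin n)
  termini x = map proj₁ (nbrs x)

  at : Fin n → V U
  at v = v , rooted v

  c : ℕ → Fin n → ℕ
  c N v = colour N (at v)

  colour≡c : ∀ N x → colour N x ≡ c N (proj₁ x)
  colour≡c N (v , p) = colour-terminus p (rooted v) noSinks cocompact N

  -- By `colour≡c`, tree neighbours matter only through their termini, so refinement descends to the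
  -- finite graph.
  c-suc : ∀ N v → c (suc N) v ≡ code (map (c N) (termini (at v)))
  c-suc N v = cong code (trans (map-cong (colour≡c N) (nbrs (at v))) (map-∘ (nbrs (at v))))

  proj₁-children : ∀ {v} (p : Path G R v) →
                   map proj₁ (children (v , p)) ≡ map t (filter (λ e → o e ≟ v) (allFin m))
  proj₁-children {v} p = begin
    map proj₁ (map (extend p) (outEdges v))    ≡⟨ map-∘ (outEdges v) ⟨
    map (proj₁ ∘ extend p) (outEdges v)        ≡⟨ map-cong (λ { (_ , refl) → refl }) (outEdges v) ⟩
    map (t ∘ proj₁) (outEdges v)               ≡⟨ map-∘ (outEdges v) ⟩
    map t (map proj₁ (outEdges v))             ≡⟨ cong (map t) (proj₁-outEdges v) ⟩
    map t (filter (λ e → o e ≟ v) (allFin m))  ∎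
    where open ≡-Reasoning

  length-children : ∀ x → length (children x) ≤ m
  length-children (v , p) = begin
    length (children (v , p))                     ≡⟨ length-map proj₁ (children (v , p)) ⟨
    length (map proj₁ (children (v , p)))         ≡⟨ cong length (proj₁-children p) ⟩
    length (map t (filter (λ e → o e ≟ v) (allFin m))) ≡⟨ length-map t (filter (λ e → o e ≟ v) (allFin m)) ⟩
    length (filter (λ e → o e ≟ v) (allFin m))    ≤⟨ length-filter (λ e → o e ≟ v) (allFin m) ⟩
    length (allFin m)                             ≡⟨ length-tabulate {n = m} id ⟩
    m                                             ∎
    where open ≤-Reasoning

  length-nbrs : ∀ x → length (nbrs x) < base
  length-nbrs x@(_ , ε)        = s≤s (≤-trans (length-children x) (n≤1+n m))
  length-nbrs x@(_ , snoc e p) = s≤s (s≤s (length-children x))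

  c-suc⇒↭ : ∀ N v w → c (suc N) v ≡ c (suc N) w → map (c N) (termini (at v)) ↭ map (c N) (termini (at w))
  c-suc⇒↭ N v w eq = code-injective (short v) (short w) (trans (sym (c-suc N v)) (trans eq (c-suc N w)))
    where
    short : ∀ u → length (map (c N) (termini (at u))) < base
    short u = subst (_< base) (sym (trans (length-map (c N) (termini (at u))) (length-map proj₁ (nbrs (at u)))))
                (length-nbrs (at u))

  -- Equal colours decode to permuted neighbour colours, which the induction hypothesis coarsens by
  -- one round.
  c-refines : ∀ N v w → c (suc N) v ≡ c (suc N) w → c N v ≡ c N w
  c-refines zero    v w eq = refl
  c-refines (suc N) v w eq = begin
    c (suc N) v                       ≡⟨ c-suc N v ⟩
    code (map (c N) (termini (at v))) ≡⟨ code-↭ (map-↭-coarsen R (c (suc N)) (c N) (c-refines N) (c-suc⇒↭ (suc N) v w eq)) ⟩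
    code (map (c N) (termini (at w))) ≡⟨ c-suc N w ⟨
    c (suc N) w                       ∎
    where open ≡-Reasoning

  -- The set of equally coloured pairs of vertices decreases with the round; `combine` codes pairs
  -- as elements of a finite type.
  c-stabilises : ∃ λ N → ∀ v w → c N v ≡ c N w → c (suc N) v ≡ c (suc N) w
  c-stabilises = proj₁ stable , λ v w → on-pair v w (proj₂ stable (combine v w))
    where
    Same : ℕ → Fin n × Fin n → Set
    Same N (v , w) = c N v ≡ c N w
    stable = decreasing-stabilises (λ N → Same N ∘ remQuot n)
               (λ N a → c N (proj₁ (remQuot {n} n a)) ℕ.≟ c N (proj₂ (remQuot {n} n a)))
               (λ N a → c-refines N (proj₁ (remQuot {n} n a)) (proj₂ (remQuot {n} n a)))
    N = proj₁ stable
    on-pair : ∀ v w → (Same N (remQuot n (combine v w)) → Same (suc N) (remQuot n (combine v w))) →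
                     Same N (v , w) → Same (suc N) (v , w)
    on-pair v w = subst (λ a → Same N a → Same (suc N) a) (remQuot-combine v w)

  N : ℕ
  N = proj₁ c-stabilises

  -- A stable colour class is named by one of its vertices, which keeps the labels in `Fin n`.
  label : Fin n → Fin n
  label v = representative R (c N) (c N v)

  neighbourLabels : V U → List (Fin n)
  neighbourLabels x = map label (termini x)

  -- The vertex `label v` has the stable colour of `v`, so by stability also the colour of `v` one
  -- round later, and that colour determines the neighbours' stable colours.
  neighbourLabels-label : ∀ v → neighbourLabels (at (label v)) ↭ neighbourLabels (at v)
  neighbourLabels-label v = map-↭-coarsen R (c N) label (λ _ _ → cong (representative R (c N)))
    (c-suc⇒↭ N (label v) v (proj₂ c-stabilises (label v) v (representative-correct R (c N) v)))

  -- The label `x` is read as a vertex; the parent, if there is one, is counted along with the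
  -- successors.
  M : Fin n → Fin n → ℕ
  M x y = count y (neighbourLabels (at x))

  M-label : ∀ v y → M (label v) y ≡ count y (neighbourLabels (at v))
  M-label v y = sum-↭ (Perm.map⁺ _ (neighbourLabels-label v))

  outLabels≡count : ∀ {v} (p : Path G R v) y → outLabels G label v y ≡ count y (map label (map proj₁ (children (v , p))))
  outLabels≡count {v} p y = begin
    outLabels G label v y
      ≡⟨ sum-filter (λ e → o e ≟ v) (λ e → does (label (t e) ≟ y)) (allFin m) ⟩
    sum (map (λ e → indicator (does (label (t e) ≟ y))) out)
      ≡⟨ cong sum (map-∘ out) ⟩
    sum (map (λ w → indicator (does (label w ≟ y))) (map t out))
      ≡⟨ cong sum (map-∘ (map t out)) ⟩
    count y (map label (map t out))
      ≡⟨ cong (count y ∘ map label) (proj₁-children p) ⟨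
    count y (map label (map proj₁ (children (v , p)))) ∎
    where
    open ≡-Reasoning
    out = filter (λ e → o e ≟ v) (allFin m)

  parentLabel : ∀ {v} → Path G R v → ¬ v ≡ R → Fin n
  parentLabel ε          v≢R = contradiction refl v≢R
  parentLabel (snoc e p) _   = label (o e)

  parentLabel-counted : ∀ {v} (p : Path G R v) v≢R → 1 ≤ count (parentLabel p v≢R) (neighbourLabels (v , p))
  parentLabel-counted ε          v≢R = contradiction refl v≢R
  parentLabel-counted (snoc e p) v≢R = count-here (label (o e)) (map label (map proj₁ (children (_ , snoc e p))))

  outLabels-∸ : ∀ {v} (p : Path G R v) v≢R y → outLabels G label v y ≡
                count y (neighbourLabels (v , p)) ∸ indicator (does (y ≟ parentLabel p v≢R))
  outLabels-∸ ε v≢R y = contradiction refl v≢R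
  outLabels-∸ (snoc e p) v≢R y = trans (outLabels≡count (snoc e p) y)
    (sym (count-∷-∸ y (label (o e)) (map label (map proj₁ (children (_ , snoc e p))))))

  -- No edge enters `R`, so the chosen path is empty and there is no parent to count. The endpoint
  -- is a variable so that the path can be matched on.
  outLabels-root : ∀ {v} (p : Path G R v) → v ≡ R → ∀ y → outLabels G label v y ≡ count y (neighbourLabels (v , p))
  outLabels-root ε          _   y = outLabels≡count ε y
  outLabels-root (snoc e p) v≡R y = contradiction v≡R (noIncoming e)

  parents-subst : ∀ {v w} (eq : w ≡ v) (p : Path G R w) → parents (v , subst (Path G R) eq p) ≡ parents (w , p)
  parents-subst refl p = refl

  colour-extend : ∀ N {w} (q q′ : Path G R w) e → colour N (extend q e) ≡ colour N (extend q′ e)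
  colour-extend N q q′ (e , refl) = colour-terminus (snoc e q) (snoc e q′) noSinks cocompact N

  -- Paths through `e` and through `e′` reach the same vertex, so they and their children have equal
  -- colours in every round; `colour-parent` then compares the origins. This makes the parent label
  -- independent of the chosen path, as condition (3) demands.
  c-origin : ∀ N e e′ → t e ≡ t e′ → c N (o e) ≡ c N (o e′)
  c-origin N e e′ eq = colour-parent N q q′ (parents-subst eq (snoc e (rooted (o e)))) refl
    (colour-extend N q q′)
    (colour-terminus q q′ noSinks cocompact (suc N))
    where
    q q′ : Path G R (t e′)
    q  = subst (Path G R) eq (snoc e (rooted (o e)))
    q′ = snoc e′ (rooted (o e′))

  label-origin : ∀ {v} (p : Path G R v) v≢R e → t e ≡ v → label (o e) ≡ parentLabel p v≢R
  label-origin ε           v≢R e eq = contradiction refl v≢R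
  label-origin (snoc e′ p) v≢R e eq = cong (representative R (c N)) (c-origin N e e′ eq)

  actualLabelling : ActualLabelling G R
  actualLabelling = record
    { k = n
    ; l = label
    ; lp = λ v → parentLabel (rooted v)
    ; M = M
    ; cond1 = λ v v≢R → subst (1 ≤_) (sym (M-label v _)) (parentLabel-counted (rooted v) v≢R)
    ; cond2 = λ v v≢R y → trans (outLabels-∸ (rooted v) v≢R y)
        (cong (_∸ indicator (does (y ≟ parentLabel (rooted v) v≢R))) (sym (M-label v y)))
    ; cond3 = λ v → label-origin (rooted v)
    ; cond4 = λ y → trans (outLabels-root (rooted R) refl y) (sym (M-label R y))
    }

theorem1p3 : (G : FinGraph) (R : Fin (FinGraph.n G)) → Rooted G R → NoSinks G → NoIncomingAt G R → CocompactUnfolding G R → ActualLabelling G R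
theorem1p3 = Labelling.actualLabelling
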